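{- Let $k\in\mathbb{N}$ with $k\ge 2$, let $n=(k+1)^2-1$, and let $T\in\operatorname{YT}(n)$ have shape $((k+1)^k,k)$. Then $\operatorname{M}_k(T)$ determines the location of $n$ in $T$.
   Context: A (standard Young) tableau of shape $\lambda$ (a partition of $n$) is a filling of the Young diagram of $\lambda$ by distinct elements of $[1,n]$ increasing strictly along rows and down columns; $\operatorname{YT}(n)$ is the set of such tableaux with entries exactly $[1,n]$. The shape $((k+1)^k,k)$ is a $(k+1)\times(k+1)$ square with its lower-right cell removed. Deletion by jeu de taquin: for $T\in\operatorname{YT}(n)$ and an entry $m$, delete the cell containing $m$; repeatedly, if there is a cell directly to the right of or directly below the empty space, slide the one with the smaller entry into it; stop when neither exists; then subtract 1 from every entry larger than $m$, giving $T-m\in\operatorname{YT}(n-1)$. A $k$-minor of $T$ is a tableau obtained by $k$ successive such deletions; $\operatorname{M}_k(T)$ is the set of all $k$-minors. "Determined by $\operatorname{M}_k(T)$" means: any $S\in\operatorname{YT}(n)$ of the same shape with $\operatorname{M}_k(S)=\operatorname{M}_k(T)$ has $n$ in the same cell as $T$. -}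

module Defs where

open import Data.Nat using (ℕ; zero; suc; _+_; _*_; _∸_; _^_; _≤_; _<_; _≥_; _<ᵇ_; _≡ᵇ_)
open import Data.Bool using (Bool; true; false; if_then_else_)
open import Data.Maybe using (Maybe; just; nothing)
open import Data.Product using (_×_; _,_; ∃-syntax)
open import Data.List using (List; []; _∷_; _++_; [_]; map; length; concat; replicate; applyUpTo; filter)
open import Data.List.Relation.Unary.All using (All)
open import Data.List.Relation.Unary.Linked using (Linked)
open import Data.List.Relation.Binary.Permutation.Propositional using (_↭_)
open import Data.List.Membership.Propositional using (_∈_)
open import Relation.Binary.PropositionalEquality using (_≡_)
open import Function.Bundles using (_⇔_)

-- A tableau is given by its list of rows (top to bottom), each row a list of
-- entries (left to right).  Cells are indexed (row i, column j), 0-based.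
Tableau : Set
Tableau = List (List ℕ)

shape : Tableau → List ℕ
shape = map length

getRow : List ℕ → ℕ → Maybe ℕ
getRow []       _       = nothing
getRow (x ∷ xs) zero    = just x
getRow (x ∷ xs) (suc j) = getRow xs j

get : Tableau → ℕ → ℕ → Maybe ℕ
get []       _       _ = nothing
get (r ∷ rs) zero    j = getRow r j
get (r ∷ rs) (suc i) j = get rs i j

setRow : List ℕ → ℕ → ℕ → List ℕ
setRow []       _       _ = []
setRow (x ∷ xs) zero    v = v ∷ xs
setRow (x ∷ xs) (suc j) v = x ∷ setRow xs j v

set : Tableau → ℕ → ℕ → ℕ → Tableau
set []       _       _ _ = []
set (r ∷ rs) zero    j v = setRow r j v ∷ rs
set (r ∷ rs) (suc i) j v = r ∷ set rs i j v

dropLast : List ℕ → List ℕ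
dropLast []           = []
dropLast (x ∷ [])     = []
dropLast (x ∷ y ∷ xs) = x ∷ dropLast (y ∷ xs)

nonEmptyRows : Tableau → Tableau
nonEmptyRows []            = []
nonEmptyRows ([] ∷ rs)     = nonEmptyRows rs
nonEmptyRows ((x ∷ r) ∷ rs) = (x ∷ r) ∷ nonEmptyRows rs

removeLastOfRow : Tableau → ℕ → Tableau
removeLastOfRow []       _       = []
removeLastOfRow (r ∷ rs) zero    = dropLast r ∷ rs
removeLastOfRow (r ∷ rs) (suc i) = r ∷ removeLastOfRow rs i

-- Jeu de taquin: the empty space is at (i , j).  If a cell lies directly to
-- the right of or directly below it, slide the one with the smaller entry
-- into the empty space (the empty space moves to where that entry was);
-- when neither exists, the empty cell is removed.  The fuel argument bounds
-- the number of slides (the number of cells always suffices).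
slide : ℕ → Tableau → ℕ → ℕ → Tableau
slide zero    t i j = nonEmptyRows (removeLastOfRow t i)
slide (suc f) t i j with get t i (suc j) | get t (suc i) j
... | nothing | nothing = nonEmptyRows (removeLastOfRow t i)
... | just a  | nothing = slide f (set t i j a) i (suc j)
... | nothing | just b  = slide f (set t i j b) (suc i) j
... | just a  | just b  = if a <ᵇ b then slide f (set t i j a) i (suc j)
                                    else slide f (set t i j b) (suc i) j

findRow : List ℕ → ℕ → ℕ → Maybe ℕ
findRow []       m j = nothing
findRow (x ∷ xs) m j = if x ≡ᵇ m then just j else findRow xs m (suc j)

findIn : Tableau → ℕ → ℕ → Maybe (ℕ × ℕ)
findIn []       m i = nothing
findIn (r ∷ rs) m i with findRow r m 0
... | just j  = just (i , j)
... | nothing = findIn rs m (suc i)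

delete : ℕ → Tableau → Tableau
delete m t with findIn t m 0
... | nothing      = t
... | just (i , j) =
  map (map (λ x → if m <ᵇ x then x ∸ 1 else x))
      (slide (length (concat t)) t i j)

data Minor : ℕ → Tableau → Tableau → Set where
  minor-zero : ∀ {T} → Minor zero T T
  minor-suc  : ∀ {k T U} (m : ℕ) → m ∈ concat T → Minor k (delete m T) U → Minor (suc k) T U

record IsYT (n : ℕ) (T : Tableau) : Set where
  field
    rowsNonEmpty  : All (λ r → 1 ≤ length r) T
    partition     : Linked _≥_ (shape T)
    entries       : concat T ↭ applyUpTo suc n
    rowIncreasing : ∀ i j a b → get T i j ≡ just a → get T i (suc j) ≡ just b → a < b
    colIncreasing : ∀ i j a b → get T i j ≡ just a → get T (suc i) j ≡ just b → a < b

squareMinusCorner : ℕ → List ℕ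
squareMinusCorner k = replicate k (suc k) ++ [ k ]

SameMinors : ℕ → Tableau → Tableau → Set
SameMinors k S T = ∀ U → Minor k S U ⇔ Minor k T U

{-# OPTIONS --safe #-}
module Submission where

-- Suppose n lies in the right corner A = (k-1,k) of T and in the bottom corner
-- B = (k,k-1) of S, and put C = (k-1,k-1).  Every entry of a minor moved there
-- from a weakly south-eastern cell, and relative order is preserved.
--
-- Deleting from T the entry above A (which pulls n up) and all of the bottom
-- row but its last entry gives a minor with entries at C, in row k and in
-- column k that increase in this order.  If it is a minor of S, then they can
-- only come from C, from row k and from column k of S, so some entry b of the
-- bottom row of S satisfies S(C) < b < S(A).
--
-- Deleting the right column of S, or S(C) (which pulls S(A) into C) and the
-- rest of the right column, gives minors with k full columns, in which b is
-- respectively larger and smaller than the entry at C.  But in such minors of T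
-- the bottom row and C keep their entries, since n sits at A: a contradiction.

open import Defs
open import Data.Bool using (true; false; T; if_then_else_)
open import Data.Empty using (⊥; ⊥-elim)
open import Data.List using (List; []; _∷_; _++_; [_]; map; length; concat; replicate)
open import Data.List.Membership.Propositional using (_∈_)
open import Data.List.Membership.Propositional.Properties using (∈-++⁺ˡ; ∈-++⁺ʳ; ∈-applyUpTo⁻; ∈-concat⁻′)
open import Data.List.Properties using (length-map)
open import Data.List.Relation.Binary.Permutation.Propositional using (↭-sym; ↭-trans; ↭⇒↭ₛ)
open import Data.List.Relation.Binary.Permutation.Propositional.Properties using (∈-resp-↭)
import Data.List.Relation.Binary.Permutation.Setoid.Properties as Permutation
open import Data.List.Relation.Unary.All using (All; []; _∷_)
import Data.List.Relation.Unary.All as All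
open import Data.List.Relation.Unary.All.Properties using (map⁺)
open import Data.List.Relation.Unary.AllPairs using ([]; _∷_)
open import Data.List.Relation.Unary.Any using (here; there)
open import Data.List.Relation.Unary.Unique.Propositional using (Unique)
open import Data.List.Relation.Unary.Unique.Propositional.Properties using (applyUpTo⁺₁)
open import Data.Maybe using (Maybe; just; nothing)
import Data.Maybe as Maybe
open import Data.Maybe.Properties using (just-injective; map-∘; map-id)
open import Data.Nat using (ℕ; zero; suc; pred; _+_; _∸_; _^_; _≤_; _<_; _<ᵇ_; _≡ᵇ_; z≤n; s≤s; >-nonZero)
open import Data.Nat.Properties
open import Data.Product using (_×_; _,_; proj₁; proj₂; ∃-syntax)
open import Data.Product.Properties using (≡-dec; ,-injective)
open import Data.Sum using (_⊎_; inj₁; inj₂)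
open import Data.Unit using (tt)
open import Function using (_∘_; id)
open import Function.Bundles using (Equivalence)
open import Relation.Binary.Definitions using (DecidableEquality; tri<; tri≈; tri>)
open import Relation.Binary.PropositionalEquality
  using (_≡_; _≢_; refl; sym; trans; cong; subst; subst₂; setoid)
open import Relation.Nullary using (¬_; does; yes; no)
open import Relation.Nullary.Decidable using (dec-true; dec-false)

private variable
  d k n m i j i′ j′ x y : ℕ
  r : List ℕ
  t u v : Tableau

-- Cell functions and their updates.

Position : Set
Position = ℕ × ℕ

Cells : Set
Cells = Position → Maybe ℕ

cell : Tableau → Cells
cell t (i , j) = get t i j

_≟ₚ_ : DecidableEquality Position
_≟ₚ_ = ≡-dec _≟_ _≟_

infixl 8 _[_≔_]
abstract
  -- Kept abstract, so that iterated updates stay opaque and are handled only through the three laws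
  -- in this block.
  _[_≔_] : Cells → Position → Maybe ℕ → Cells
  (F [ p ≔ c ]) q = if does (p ≟ₚ q) then c else F q

  ≔-same : ∀ (F : Cells) p {c} → (F [ p ≔ c ]) p ≡ c
  ≔-same F p rewrite dec-true (p ≟ₚ p) refl = refl

  ≔-other : ∀ (F : Cells) {p q c} → p ≢ q → (F [ p ≔ c ]) q ≡ F q
  ≔-other F {p} {q} p≢q rewrite dec-false (p ≟ₚ q) p≢q = refl

  ≔-intro : ∀ {F : Cells} {p q b c} → (p ≡ q → b ≡ c) → (p ≢ q → b ≡ F q) → b ≡ (F [ p ≔ c ]) q
  ≔-intro {p = p} {q} same other with p ≟ₚ q
  ... | yes p≡q = same p≡q
  ... | no  p≢q = other p≢q

row≢ : i ≢ i′ → (i , j) ≢ (i′ , j′)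
row≢ i≢i′ = i≢i′ ∘ proj₁ ∘ ,-injective

column≢ : j ≢ j′ → (i , j) ≢ (i′ , j′)
column≢ j≢j′ = j≢j′ ∘ proj₂ ∘ ,-injective

just≢nothing : ∀ {c : Maybe ℕ} → c ≡ just x → c ≢ nothing
just≢nothing refl ()

-- The relabelling performed by a deletion.

lower : ℕ → ℕ → ℕ
lower m x = if m <ᵇ x then x ∸ 1 else x

lower-above : m < x → lower m x ≡ pred x
lower-above {m} {suc x} m<x with m <ᵇ suc x in e
... | true  = refl
... | false = ⊥-elim (subst T e (<⇒<ᵇ m<x))

lower-below : x ≤ m → lower m x ≡ x
lower-below {x} {m} x≤m with m <ᵇ x in e
... | false = refl
... | true  = ⊥-elim (<⇒≱ (<ᵇ⇒< m x (subst T (sym e) tt)) x≤m)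

lower-mono : ∀ m → x ≤ y → lower m x ≤ lower m y
lower-mono {x} {y} m x≤y with m <? x | m <? y
... | yes m<x | yes m<y rewrite lower-above m<x | lower-above m<y = pred-mono-≤ x≤y
... | yes m<x | no  m≮y = ⊥-elim (m≮y (<-≤-trans m<x x≤y))
... | no  m≮x | yes m<y rewrite lower-below (≮⇒≥ m≮x) | lower-above m<y =
  ≤-trans (≮⇒≥ m≮x) (pred-mono-≤ m<y)
... | no  m≮x | no  m≮y rewrite lower-below (≮⇒≥ m≮x) | lower-below (≮⇒≥ m≮y) = x≤y

-- `lower m` merges `m` with `suc m` and no other pair, so it is strict away from the deleted value
-- `m`.
lower-mono-< : x ≢ m → y ≢ m → x < y → lower m x < lower m y
lower-mono-< {x} {m} {y} x≢m y≢m x<y with m <? x | m <? y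
... | yes m<x | yes m<y rewrite lower-above m<x | lower-above m<y =
  pred-mono-< {{>-nonZero (≤-<-trans z≤n m<x)}} x<y
... | yes m<x | no  m≮y = ⊥-elim (m≮y (<-trans m<x x<y))
... | no  m≮x | yes m<y rewrite lower-below (≮⇒≥ m≮x) | lower-above m<y =
  <-≤-trans (≤∧≢⇒< (≮⇒≥ m≮x) x≢m) (pred-mono-≤ m<y)
... | no  m≮x | no  m≮y rewrite lower-below (≮⇒≥ m≮x) | lower-below (≮⇒≥ m≮y) = x<y

-- Cells under mapping, overwriting and shortening of rows.

getRow-map : ∀ (f : ℕ → ℕ) r j → getRow (map f r) j ≡ Maybe.map f (getRow r j)
getRow-map f []      j       = refl
getRow-map f (x ∷ r) zero    = refl
getRow-map f (x ∷ r) (suc j) = getRow-map f r j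

cell-map : ∀ (f : ℕ → ℕ) t p → cell (map (map f) t) p ≡ Maybe.map f (cell t p)
cell-map f []      p           = refl
cell-map f (r ∷ t) (zero  , j) = getRow-map f r j
cell-map f (r ∷ t) (suc i , j) = cell-map f t (i , j)

getRow-∈ : ∀ r → getRow r j ≡ just x → x ∈ r
getRow-∈ {zero}  (x ∷ r) refl = here refl
getRow-∈ {suc j} (x ∷ r) e    = there (getRow-∈ r e)

cell-∈ : ∀ t → get t i j ≡ just x → x ∈ concat t
cell-∈ {zero}  (r ∷ t) e = ∈-++⁺ˡ (getRow-∈ r e)
cell-∈ {suc i} (r ∷ t) e = ∈-++⁺ʳ r (cell-∈ t e)

∈-getRow : ∀ r → x ∈ r → ∃[ j ] getRow r j ≡ just x
∈-getRow (x ∷ r) (here refl) = 0 , refl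
∈-getRow (x ∷ r) (there x∈r) with j , e ← ∈-getRow r x∈r = suc j , e

∈-cell : ∀ t → x ∈ concat t → ∃[ p ] cell t p ≡ just x
∈-cell {x} t x∈t with r , x∈r , r∈t ← ∈-concat⁻′ t x∈t = go t r∈t
  where
  go : ∀ t → r ∈ t → ∃[ p ] cell t p ≡ just x
  go (r ∷ t) (here refl) with j , e ← ∈-getRow r x∈r = (0 , j) , e
  go (r ∷ t) (there r∈t) with (i , j) , e ← go t r∈t = (suc i , j) , e

setRow-same : ∀ r → getRow r j ≡ just x → getRow (setRow r j y) j ≡ just y
setRow-same {zero}  (x ∷ r) e = refl
setRow-same {suc j} (x ∷ r) e = setRow-same r e

setRow-other : ∀ r j → j ≢ j′ → getRow (setRow r j y) j′ ≡ getRow r j′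
setRow-other []      j       j≢j′ = refl
setRow-other {zero}  (x ∷ r) zero    j≢j′ = ⊥-elim (j≢j′ refl)
setRow-other {suc _} (x ∷ r) zero    j≢j′ = refl
setRow-other {zero}  (x ∷ r) (suc j) j≢j′ = refl
setRow-other {suc _} (x ∷ r) (suc j) j≢j′ = setRow-other r j (j≢j′ ∘ cong suc)

cell-set-same : ∀ t → get t i j ≡ just x → get (set t i j y) i j ≡ just y
cell-set-same {zero}  (r ∷ t) e = setRow-same r e
cell-set-same {suc i} (r ∷ t) e = cell-set-same t e

cell-set-other : ∀ t i {j p} → (i , j) ≢ p → cell (set t i j y) p ≡ cell t p
cell-set-other []      i       p≢q = refl
cell-set-other (r ∷ t) zero {p = zero , _} p≢q = setRow-other r _ (p≢q ∘ cong (0 ,_))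
cell-set-other (r ∷ t) zero {p = suc _ , _} p≢q = refl
cell-set-other (r ∷ t) (suc i) {p = zero , _} p≢q = refl
cell-set-other (r ∷ t) (suc i) {p = suc _ , _} p≢q =
  cell-set-other t i (p≢q ∘ λ where refl → refl)

dropLast-⊆ : ∀ r j → getRow (dropLast r) j ≡ just x → getRow r j ≡ just x
dropLast-⊆ (x ∷ y ∷ r) zero    e = e
dropLast-⊆ (x ∷ y ∷ r) (suc j) e = dropLast-⊆ (y ∷ r) j e

dropLast-last : ∀ r j → getRow r (suc j) ≡ nothing → getRow (dropLast r) j ≡ nothing
dropLast-last []          j       e = refl
dropLast-last (x ∷ [])    j       e = refl
dropLast-last (x ∷ y ∷ r) (suc j) e = dropLast-last (y ∷ r) j e

dropLast-other : ∀ r j j′ → getRow r j ≡ just x → getRow r (suc j) ≡ nothing → j ≢ j′ →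
                 getRow (dropLast r) j′ ≡ getRow r j′
dropLast-other (x ∷ [])    zero    zero     _  _  j≢j′ = ⊥-elim (j≢j′ refl)
dropLast-other (x ∷ [])    zero    (suc j′) _  _  j≢j′ = refl
dropLast-other (x ∷ y ∷ r) (suc j) zero     e₁ e₂ j≢j′ = refl
dropLast-other (x ∷ y ∷ r) (suc j) (suc j′) e₁ e₂ j≢j′ =
  dropLast-other (y ∷ r) j j′ e₁ e₂ (j≢j′ ∘ cong suc)

removeLast-last : ∀ t i {j} → get t i (suc j) ≡ nothing → get (removeLastOfRow t i) i j ≡ nothing
removeLast-last []      i       e = refl
removeLast-last (r ∷ t) zero    e = dropLast-last r _ e
removeLast-last (r ∷ t) (suc i) e = removeLast-last t i e

removeLast-other : ∀ t i {j p} → get t i j ≡ just x → get t i (suc j) ≡ nothing → (i , j) ≢ p →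
                   cell (removeLastOfRow t i) p ≡ cell t p
removeLast-other (r ∷ t) zero {p = zero , _} e₁ e₂ p≢q =
  dropLast-other r _ _ e₁ e₂ (p≢q ∘ cong (0 ,_))
removeLast-other (r ∷ t) zero {p = suc _ , _} e₁ e₂ p≢q = refl
removeLast-other (r ∷ t) (suc i) {p = zero , _} e₁ e₂ p≢q = refl
removeLast-other (r ∷ t) (suc i) {p = suc _ , _} e₁ e₂ p≢q =
  removeLast-other t i e₁ e₂ (p≢q ∘ λ where refl → refl)

-- Cells of minors come from the south-east

infix 4 _⊴_ _≼_
_⊴_ : Position → Position → Set
(i , j) ⊴ (i′ , j′) = i ≤ i′ × j ≤ j′

⊴-refl : ∀ {p} → p ⊴ p
⊴-refl = ≤-refl , ≤-refl

⊴-trans : ∀ {p q s} → p ⊴ q → q ⊴ s → p ⊴ s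
⊴-trans (a , b) (c , d) = ≤-trans a c , ≤-trans b d

record _≼_ (u t : Tableau) : Set where
  constructor mk≼
  field
    source : ∀ p {x} → cell u p ≡ just x → ∃[ q ] p ⊴ q × cell t q ≡ just x

open _≼_

≼-trans : u ≼ v → v ≼ t → u ≼ t
source (≼-trans u≼v v≼t) p e with q , p⊴q , e′ ← source u≼v p e
  with s , q⊴s , e″ ← source v≼t q e′ = s , ⊴-trans p⊴q q⊴s , e″

-- Dropping an empty row lifts the rows under it, so sources lie weakly further down in the same
-- column.
nonEmptyRows-≼ : ∀ t → nonEmptyRows t ≼ t
source (nonEmptyRows-≼ ([] ∷ t)) p e with (i , j) , (a , b) , e′ ← source (nonEmptyRows-≼ t) p e =
  (suc i , j) , (m≤n⇒m≤1+n a , b) , e′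
source (nonEmptyRows-≼ ((x ∷ r) ∷ t)) (zero  , j) e = (0 , j) , ⊴-refl , e
source (nonEmptyRows-≼ ((x ∷ r) ∷ t)) (suc i , j) e
  with (i′ , j′) , (a , b) , e′ ← source (nonEmptyRows-≼ t) (i , j) e =
  (suc i′ , j′) , (s≤s a , b) , e′

removeLast-≼ : ∀ t i → removeLastOfRow t i ≼ t
source (removeLast-≼ t i) p e = p , ⊴-refl , go t i p e
  where
  go : ∀ t i p → cell (removeLastOfRow t i) p ≡ just x → cell t p ≡ just x
  go (r ∷ t) zero    (zero  , j) e = dropLast-⊆ r j e
  go (r ∷ t) zero    (suc _ , j) e = e
  go (r ∷ t) (suc i) (zero  , j) e = e
  go (r ∷ t) (suc i) (suc _ , j) e = go t i _ e

set-≼ : ∀ t {i j q} → (i , j) ⊴ q → cell t q ≡ just x → set t i j x ≼ t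
source (set-≼ {x} t {i} {j} {q} p⊴q e) s e′ with (i , j) ≟ₚ s
... | no  p≢s  = s , ⊴-refl , trans (sym (cell-set-other t i p≢s)) e′
... | yes refl with get t i j in e″
...   | just _  = q , p⊴q , trans e (trans (sym (cell-set-same t e″)) e′)
-- `set` outside the tableau writes nothing, so the cell stays empty.
...   | nothing = ⊥-elim (go t i e″ e′)
  where
  goRow : ∀ r j → getRow r j ≡ nothing → getRow (setRow r j x) j ≡ just y → ⊥
  goRow (_ ∷ r) (suc j) = goRow r j
  go : ∀ t i → get t i j ≡ nothing → get (set t i j x) i j ≡ just y → ⊥
  go (r ∷ t) zero    = goRow r j
  go (r ∷ t) (suc i) = go t i

-- Each move copies the right or lower neighbour of the hole into it; stopping only removes a cell
-- and lifts rows.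
slide-≼ : ∀ f t i j → slide f t i j ≼ t
slide-≼ zero t i j = ≼-trans (nonEmptyRows-≼ _) (removeLast-≼ t i)
slide-≼ (suc f) t i j with get t i (suc j) in eʳ | get t (suc i) j in eᵈ
... | nothing | nothing = ≼-trans (nonEmptyRows-≼ _) (removeLast-≼ t i)
... | just a  | nothing = ≼-trans (slide-≼ f _ i (suc j)) (set-≼ t (≤-refl , n≤1+n j) eʳ)
... | nothing | just b  = ≼-trans (slide-≼ f _ (suc i) j) (set-≼ t (n≤1+n i , ≤-refl) eᵈ)
... | just a  | just b with a <ᵇ b
...   | true  = ≼-trans (slide-≼ f _ i (suc j)) (set-≼ t (≤-refl , n≤1+n j) eʳ)
...   | false = ≼-trans (slide-≼ f _ (suc i) j) (set-≼ t (n≤1+n i , ≤-refl) eᵈ)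

-- `label` collects the subtractions made along the way. It is only weakly monotone, since `lower m`
-- merges two values, but this suffices to read strict inequalities of `u` back into `t`.
record Traced (u t : Tableau) : Set where
  field
    label      : ℕ → ℕ
    label-mono : x ≤ y → label x ≤ label y
    origin     : ∀ p {x} → cell u p ≡ just x →
                 ∃[ q ] ∃[ y ] p ⊴ q × cell t q ≡ just y × label y ≡ x

  reflects-< : label x < label y → x < y
  reflects-< lx<ly = ≰⇒> λ y≤x → <⇒≱ lx<ly (label-mono y≤x)

delete-traced : ∀ m t → Traced (delete m t) t
delete-traced m t with findIn t m 0
... | nothing = record { label = id ; label-mono = id ; origin = λ p e → p , _ , ⊴-refl , e , refl }
... | just (i , j) = record { label = lower m ; label-mono = lower-mono m ; origin = origin }
  where
  origin : ∀ p {x} → cell (map (map (lower m)) (slide (length (concat t)) t i j)) p ≡ just x →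
           ∃[ q ] ∃[ y ] p ⊴ q × cell t q ≡ just y × lower m y ≡ x
  origin p e rewrite cell-map (lower m) (slide (length (concat t)) t i j) p
    with cell (slide (length (concat t)) t i j) p in e′
  origin p refl | just y with q , p⊴q , e″ ← source (slide-≼ (length (concat t)) t i j) p e′ = q , y , p⊴q , e″ , refl

traced-trans : Traced u v → Traced v t → Traced u t
traced-trans A B = record
  { label      = A.label ∘ B.label
  ; label-mono = A.label-mono ∘ B.label-mono
  ; origin     = λ p e →
      let q , y , p⊴q , e′ , ay≡x = A.origin p e
          s , z , q⊴s , e″ , bz≡y = B.origin q e′
      in s , z , ⊴-trans p⊴q q⊴s , e″ , trans (cong A.label bz≡y) ay≡x
  }
  where
  module A = Traced A
  module B = Traced B

minor-traced : Minor d t u → Traced u t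
minor-traced minor-zero         = record
  { label = id ; label-mono = id ; origin = λ p e → p , _ , ⊴-refl , e , refl }
minor-traced (minor-suc m _ mn) = traced-trans (minor-traced mn) (delete-traced m _)

-- Computing deletions whose slide has at most one move

findRow-absent : ∀ r c → (∀ j → getRow r j ≢ just m) → findRow r m c ≡ nothing
findRow-absent []          c absent = refl
findRow-absent {m} (x ∷ r) c absent with x ≡ᵇ m in e
... | true  = ⊥-elim (absent 0 (cong just (≡ᵇ⇒≡ x m (subst T (sym e) tt))))
... | false = findRow-absent r (suc c) (absent ∘ suc)

findRow-unique : ∀ r c → getRow r j ≡ just m → (∀ j′ → getRow r j′ ≡ just m → j′ ≡ j) →
                 findRow r m c ≡ just (j + c)
findRow-unique {zero} {m} (x ∷ r) c e unique with x ≡ᵇ m in e′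
... | true  = refl
... | false = ⊥-elim (subst T e′ (≡⇒≡ᵇ x m (just-injective e)))
findRow-unique {suc j} {m} (x ∷ r) c e unique with x ≡ᵇ m in e′
... | true with () ← unique 0 (cong just (≡ᵇ⇒≡ x m (subst T (sym e′) tt)))
... | false = trans
  (findRow-unique r (suc c) e (λ j′ e″ → suc-injective (unique (suc j′) e″)))
  (cong just (+-suc j c))

findIn-unique : ∀ t c → get t i j ≡ just m → (∀ q → cell t q ≡ just m → q ≡ (i , j)) →
                findIn t m c ≡ just (i + c , j)
findIn-unique {zero} {j} (r ∷ t) c e unique
  rewrite findRow-unique r 0 e (λ j′ e′ → cong proj₂ (unique (0 , j′) e′)) | +-identityʳ j = refl
findIn-unique {suc i} {j} (r ∷ t) c e unique
  rewrite findRow-absent r 0 (λ j′ e′ → 0≢1+n (cong proj₁ (unique (0 , j′) e′))) = trans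
  (findIn-unique t (suc c) e λ (i′ , j′) e′ →
    cong (λ (a , b) → pred a , b) (unique (suc i′ , j′) e′))
  (cong (λ a → just (a , j)) (+-suc i c))

NonEmpty : List ℕ → Set
NonEmpty r = 1 ≤ length r

nonEmptyRows-id : All NonEmpty t → nonEmptyRows t ≡ t
nonEmptyRows-id []                          = refl
nonEmptyRows-id {(x ∷ r) ∷ t} (_ ∷ allNE) = cong ((x ∷ r) ∷_) (nonEmptyRows-id allNE)

set-nonEmpty : ∀ t i → All NonEmpty t → All NonEmpty (set t i j y)
set-nonEmpty []      i       []        = []
set-nonEmpty {j} ((x ∷ r) ∷ t) zero (ne ∷ nes) = go j ∷ nes
  where
  go : ∀ j → NonEmpty (setRow (x ∷ r) j y)
  go zero    = s≤s z≤n
  go (suc _) = s≤s z≤n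
set-nonEmpty (r ∷ t) (suc i) (ne ∷ nes) = ne ∷ set-nonEmpty t i nes

removeLast-nonEmpty : ∀ t i → get t i (suc j) ≡ just x → All NonEmpty t →
                      All NonEmpty (removeLastOfRow t i)
removeLast-nonEmpty ((_ ∷ _ ∷ _) ∷ t) zero e (_ ∷ nes) = s≤s z≤n ∷ nes
removeLast-nonEmpty (r ∷ t) (suc i) e (ne ∷ nes) = ne ∷ removeLast-nonEmpty t i e nes

map-nonEmpty : ∀ (f : ℕ → ℕ) → All NonEmpty t → All NonEmpty (map (map f) t)
map-nonEmpty f = map⁺ ∘ All.map λ {r} → subst (1 ≤_) (sym (length-map f r))

-- A hole path with at most one move. In `right` the entry below is absent or larger; `down` covers
-- only an absent right neighbour.
data Hop (F : Cells) : Position → Position → Set where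
  stay  : ∀ {p} → Hop F p p
  right : F (i , suc j) ≡ just x → (∀ {y} → F (suc i , j) ≡ just y → x < y) →
          Hop F (i , j) (i , suc j)
  down  : F (i , suc j) ≡ nothing → F (suc i , j) ≡ just y → Hop F (i , j) (suc i , j)

Corner : Cells → Position → Set
Corner F (i , j) = F (i , suc j) ≡ nothing × F (suc i , j) ≡ nothing

-- The net effect of a hop from `p` to `q`. When the two coincide the second update wins, and the
-- cell is simply erased.
_[_↤_] : Cells → Position → Position → Cells
F [ p ↤ q ] = F [ p ≔ F q ] [ q ≔ nothing ]

SlidesTo : Tableau → Cells → Set
SlidesTo t F = (∀ q → cell t q ≡ F q) × All NonEmpty t

-- A hole at a corner stops at once, whatever the fuel. The column is a successor, so the shortened
-- row keeps an entry, `nonEmptyRows` changes nothing and no row shifts.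
slide-corner : ∀ f t → All NonEmpty t → get t i (suc j) ≡ just x → Corner (cell t) (i , suc j) →
               SlidesTo (slide f t i (suc j)) (cell t [ i , suc j ≔ nothing ])
slide-corner {i} {j} f t nes e (eʳ , eᵈ) = subst (λ s → SlidesTo s _) (sym (stop f)) (cells , nes′)
  where
  nes′ = removeLast-nonEmpty t i e nes
  stop : ∀ f → slide f t i (suc j) ≡ removeLastOfRow t i
  stop zero    = nonEmptyRows-id nes′
  stop (suc f) rewrite eʳ | eᵈ = nonEmptyRows-id nes′
  cells : ∀ q → cell (removeLastOfRow t i) q ≡ (cell t [ i , suc j ≔ nothing ]) q
  cells q = ≔-intro (λ where refl → removeLast-last t i eʳ) (removeLast-other t i e eʳ)

slide-hop : ∀ f t {p} → All NonEmpty t → cell t p ≡ just x → Hop (cell t) p (i , suc j) →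
            cell t (i , suc j) ≡ just y → Corner (cell t) (i , suc j) →
            SlidesTo (slide (suc f) t (proj₁ p) (proj₂ p)) (cell t [ p ↤ (i , suc j) ])
slide-hop f t {p} nes e stay e′ c with cells , nes′ ← slide-corner (suc f) t nes e c =
  (λ q → trans (cells q) (unchanged q)) , nes′
  where
  unchanged : ∀ q → (cell t [ p ≔ nothing ]) q ≡ (cell t [ p ↤ p ]) q
  unchanged q = ≔-intro
    (λ where refl → ≔-same (cell t) p)
    (λ p≢q → trans (≔-other (cell t) p≢q) (sym (≔-other (cell t) p≢q)))
slide-hop {i = i} {j} {y} f t {p@(i₀ , j₀)} nes e hop e′ (eʳ , eᵈ) = after-move hop
  where
  t′ = set t i₀ j₀ y
  -- The three inequalities ensure that writing into `p` affects neither the corner nor its right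
  -- and lower neighbours, so it is still a corner after the move.
  moved : slide (suc f) t i₀ j₀ ≡ slide f t′ i (suc j) →
          p ≢ (i , suc j) → p ≢ (i , suc (suc j)) → p ≢ (suc i , suc j) →
          SlidesTo (slide (suc f) t i₀ j₀) (cell t [ p ↤ (i , suc j) ])
  moved eq ≢₀ ≢ʳ ≢ᵈ with cells , nes′ ← slide-corner f t′ (set-nonEmpty t i₀ nes)
                           (trans (cell-set-other t i₀ ≢₀) e′)
                           (trans (cell-set-other t i₀ ≢ʳ) eʳ , trans (cell-set-other t i₀ ≢ᵈ) eᵈ) =
    subst (λ s → SlidesTo s _) (sym eq) ((λ q → trans (cells q) (agree q)) , nes′)
    where
    agree : ∀ q → (cell t′ [ i , suc j ≔ nothing ]) q ≡ (cell t [ p ↤ (i , suc j) ]) q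
    agree q = ≔-intro
      (λ where refl → ≔-same (cell t′) q)
      (λ ≢q → trans (≔-other (cell t′) ≢q) (≔-intro
        (λ where refl → trans (cell-set-same t e) (sym e′))
        (cell-set-other t i₀)))
  after-move : Hop (cell t) p (i , suc j) → SlidesTo (slide (suc f) t i₀ j₀) (cell t [ p ↤ (i , suc j) ])
  after-move stay = slide-hop f t nes e stay e′ (eʳ , eᵈ)
  after-move (right {x = a} eₐ below) =
    moved go (column≢ (<⇒≢ (n<1+n _))) (column≢ (<⇒≢ (m<n⇒m<1+n (n<1+n _)))) (row≢ (<⇒≢ (n<1+n _)))
    where
    go : slide (suc f) t i₀ j₀ ≡ slide f t′ i (suc j)
    go with refl ← just-injective (trans (sym eₐ) e′) with get t (suc i) j
    ... | nothing rewrite eₐ = refl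
    ... | just b with a <ᵇ b in lt
    ...   | true  rewrite eₐ | lt = refl
    ...   | false = ⊥-elim (subst T lt (<⇒<ᵇ (below refl)))
  after-move (down eₐ eᵦ) =
    moved go (row≢ (<⇒≢ (n<1+n _))) (row≢ (<⇒≢ (n<1+n _))) (row≢ (<⇒≢ (m<n⇒m<1+n (n<1+n _))))
    where
    go : slide (suc f) t i₀ j₀ ≡ slide f t′ i (suc j)
    go with refl ← just-injective (trans (sym eᵦ) e′) rewrite eₐ | eᵦ = refl

-- Deletions computed with the original entries.

↤-origin : ∀ {F p q} s → (F [ p ↤ q ]) s ≡ just y →
           q ≢ s × ((p ≡ s × F q ≡ just y) ⊎ (p ≢ s × F s ≡ just y))
↤-origin {y} {F} {p} {q} s e with q ≟ₚ s
... | yes refl = ⊥-elim (just≢nothing e (≔-same _ q))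
... | no  q≢s  = q≢s , go
  where
  e′ : (F [ p ≔ F q ]) s ≡ just y
  e′ = trans (sym (≔-other _ q≢s)) e
  go : (p ≡ s × F q ≡ just y) ⊎ (p ≢ s × F s ≡ just y)
  go with p ≟ₚ s
  ... | yes refl = inj₁ (refl , trans (sym (≔-same F p)) e′)
  ... | no  p≢s  = inj₂ (p≢s , trans (sym (≔-other F p≢s)) e′)

map-just : ∀ {f : ℕ → ℕ} {c} → Maybe.map f c ≡ just y → ∃[ x ] c ≡ just x × f x ≡ y
map-just {c = just x} refl = x , refl , refl

-- `F` keeps the entries of the starting tableau while `label` accumulates the subtractions.
-- Strictness is asked only for values occurring in `F`, because deleted values may be merged with
-- others.
record Represents (F : Cells) (t : Tableau) : Set where
  field
    label     : ℕ → ℕ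
    label-<   : ∀ p q {x y} → F p ≡ just x → F q ≡ just y → x < y → label x < label y
    cells     : ∀ p → cell t p ≡ Maybe.map label (F p)
    injective : ∀ p q {x} → F p ≡ just x → F q ≡ just x → p ≡ q
    nonEmpty  : All NonEmpty t

  label-injective : ∀ p q {x y} → F p ≡ just x → F q ≡ just y → label x ≡ label y → x ≡ y
  label-injective p q {x} {y} e e′ eq with <-cmp x y
  ... | tri< x<y _ _ = ⊥-elim (<⇒≢ (label-< p q e e′ x<y) eq)
  ... | tri≈ _ x≡y _ = x≡y
  ... | tri> _ _ y<x = ⊥-elim (<⇒≢ (label-< q p e′ e y<x) (sym eq))

  cell-just : ∀ p {x} → F p ≡ just x → cell t p ≡ just (label x)
  cell-just p e = trans (cells p) (cong (Maybe.map label) e)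

  cell-nothing : ∀ p → F p ≡ nothing → cell t p ≡ nothing
  cell-nothing p e = trans (cells p) (cong (Maybe.map label) e)

delete-at : ∀ t → findIn t m 0 ≡ just (i , j) →
            delete m t ≡ map (map (lower m)) (slide (length (concat t)) t i j)
delete-at t e rewrite e = refl

-- The entry to delete is the label of `x`. Injectivity makes `findIn` return `p`, and since labels
-- preserve order the hole moves in `t` as in `F`. Afterwards `x` is gone, so `lower` is strict on
-- the labels that remain.
represents-delete : ∀ {F t p} → Represents F t → F p ≡ just x → Hop F p (i , suc j) →
                    F (i , suc j) ≡ just y → Corner F (i , suc j) →
                    ∃[ m ] m ∈ concat t × Represents (F [ p ↤ (i , suc j) ]) (delete m t)
represents-delete {x} {i} {j} {y} {F} {t} {p@(i₀ , j₀)} R eₓ hop e′ (eʳ , eᵈ) =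
  m₀ , m∈t , subst (Represents _) (sym (delete-at t found)) R′
  where
  open Represents R
  q₀ : Position
  q₀ = i , suc j
  m₀ : ℕ
  m₀ = label x
  m∈t : m₀ ∈ concat t
  m∈t = cell-∈ t (cell-just p eₓ)
  found : findIn t m₀ 0 ≡ just p
  found = trans (findIn-unique t 0 (cell-just p eₓ) unique) (cong (λ a → just (a , j₀)) (+-identityʳ i₀))
    where
    unique : ∀ q → cell t q ≡ just m₀ → q ≡ p
    unique q e with z , e″ , eq ← map-just (trans (sym (cells q)) e)
      with refl ← label-injective q p e″ eₓ eq = injective q p e″ eₓ
  hopₜ : ∀ {q} → Hop F p q → Hop (cell t) p q
  hopₜ stay = stay
  hopₜ (right {i} {j} {a} eₐ below) = right (cell-just _ eₐ) λ e →
    let b , eᵦ , eq = map-just (trans (sym (cells (suc i , j))) e)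
    in subst (label a <_) eq (label-< _ (suc i , j) eₐ eᵦ (below eᵦ))
  hopₜ (down eₐ eᵦ) = down (cell-nothing _ eₐ) (cell-just _ eᵦ)
  slid : SlidesTo (slide (length (concat t)) t i₀ j₀) (cell t [ p ↤ q₀ ])
  -- Since `m₀` occurs in `concat t`, the fuel is a successor, which leaves room for the one
  -- possible move.
  slid with concat t | m∈t
  ... | _ ∷ xs | _ = slide-hop (length xs) t nonEmpty (cell-just p eₓ) (hopₜ hop) (cell-just q₀ e′)
                       (cell-nothing _ eʳ , cell-nothing _ eᵈ)
  F′ : Cells
  F′ = F [ p ↤ q₀ ]
  labelled : ∀ s → (cell t [ p ↤ q₀ ]) s ≡ Maybe.map label (F′ s)
  labelled s = sym (≔-intro
    (λ where refl → cong (Maybe.map label) (≔-same _ s))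
    (λ q₀≢s → ≔-intro
      (λ where refl → trans (cong (Maybe.map label) (trans (≔-other _ q₀≢s) (≔-same F s)))
                            (sym (cells q₀)))
      (λ p≢s → trans (cong (Maybe.map label) (trans (≔-other _ q₀≢s) (≔-other F p≢s)))
                     (sym (cells s)))))
  origin : ∀ s {z} → F′ s ≡ just z → ∃[ s′ ] s′ ≢ p × F s′ ≡ just z
  origin s e with ↤-origin s e
  ... | q₀≢s , inj₁ (refl , e″) = q₀ , q₀≢s , e″
  ... | q₀≢s , inj₂ (p≢s , e″)  = s , p≢s ∘ sym , e″
  not-m : ∀ {s z} → s ≢ p → F s ≡ just z → label z ≢ m₀
  not-m {s} s≢p e eq with refl ← label-injective s p e eₓ eq = s≢p (injective s p e eₓ)
  injective′ : ∀ s s′ {z} → F′ s ≡ just z → F′ s′ ≡ just z → s ≡ s′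
  injective′ s s′ e e″ with ↤-origin s e | ↤-origin s′ e″
  ... | _    , inj₁ (refl , _)  | _     , inj₁ (refl , _)  = refl
  ... | _    , inj₁ (refl , eq) | q₀≢s′ , inj₂ (_ , eq′)   = ⊥-elim (q₀≢s′ (injective _ _ eq eq′))
  ... | q₀≢s , inj₂ (_ , eq)    | _     , inj₁ (refl , eq′) = ⊥-elim (q₀≢s (injective _ _ eq′ eq))
  ... | _    , inj₂ (_ , eq)    | _     , inj₂ (_ , eq′)   = injective _ _ eq eq′
  R′ : Represents F′ (map (map (lower m₀)) (slide (length (concat t)) t i₀ j₀))
  R′ = record
    { label     = lower m₀ ∘ label
    ; label-<   = λ s s′ e e″ z<z′ →
        let a , a≢p , eₐ = origin s e
            b , b≢p , eᵦ = origin s′ e″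
        in lower-mono-< (not-m a≢p eₐ) (not-m b≢p eᵦ) (label-< a b eₐ eᵦ z<z′)
    ; cells     = λ s → trans (cell-map (lower m₀) (slide (length (concat t)) t i₀ j₀) s)
        (trans (cong (Maybe.map (lower m₀)) (trans (proj₁ slid s) (labelled s)))
               (sym (map-∘ (F′ s))))
    ; injective = injective′
    ; nonEmpty  = map-nonEmpty (lower m₀) (proj₂ slid)
    }

-- Chains of deletions.

infix 4 _⟶[_]_
-- Quantifying over every represented tableau lets chains compose whatever relabelling has already
-- taken place.
_⟶[_]_ : Cells → ℕ → Cells → Set
F ⟶[ d ] F′ = ∀ {t} → Represents F t → ∃[ u ] Minor d t u × Represents F′ u

⟶-refl : ∀ {F} → F ⟶[ 0 ] F
⟶-refl R = _ , minor-zero , R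

⟶-step : ∀ {F F′ p} → F p ≡ just x → Hop F p (i , suc j) → F (i , suc j) ≡ just y →
         Corner F (i , suc j) → F [ p ↤ (i , suc j) ] ⟶[ d ] F′ → F ⟶[ suc d ] F′
⟶-step e hop e′ c steps R with m , m∈t , R′ ← represents-delete R e hop e′ c
  with u , minor , R″ ← steps R′ = u , minor-suc m m∈t minor , R″

↤-unmoved : ∀ {F p q s} → p ≢ s → q ≢ s → (F [ p ↤ q ]) s ≡ F s
↤-unmoved {F} p≢s q≢s = trans (≔-other _ q≢s) (≔-other F p≢s)

↤-moved : ∀ {F p q} → q ≢ p → (F [ p ↤ q ]) p ≡ F q
↤-moved {F} q≢p = trans (≔-other _ q≢p) (≔-same F _)

n≢1+n : n ≢ suc n
n≢1+n ()

-- The column is deleted from the bottom up: its lowest entry has nothing to the right or below, so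
-- it disappears without any slide.
erase-column : ∀ d {F} → (∀ {i} → i < d → ∃[ x ] F (i , suc j) ≡ just x) →
               (∀ i → F (i , suc (suc j)) ≡ nothing) → F (d , suc j) ≡ nothing →
               ∃[ F′ ] F ⟶[ d ] F′ × (∀ p → proj₂ p ≢ suc j → F′ p ≡ F p)
erase-column zero {F} filled beyond below = F , ⟶-refl , λ _ _ → refl
erase-column {j} (suc d) {F} filled beyond below =
  let x , e = filled (n<1+n d)
      F′ , steps , agree = erase-column d {F [ (d , suc j) ↤ (d , suc j) ]}
        (λ i<d → let y , e′ = filled (m<n⇒m<1+n i<d) in
          y , trans (unmoved (row≢ (>⇒≢ i<d))) e′)
        (λ i → trans (unmoved (column≢ n≢1+n)) (beyond i))
        (≔-same _ _)
  in F′ , ⟶-step e stay e (beyond d , below) steps ,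
     λ p p≢ → trans (agree p p≢) (unmoved (column≢ (p≢ ∘ sym)))
  where
  unmoved : ∀ {q p} → p ≢ q → (F [ p ↤ p ]) q ≡ F q
  unmoved p≢q = ↤-unmoved p≢q p≢q

-- The last entry of row i travels to column 0.
contract-row : ∀ i d {F} → (∀ {j} → j ≤ d → ∃[ y ] F (i , j) ≡ just y) → F (i , d) ≡ just x →
               F (i , suc d) ≡ nothing → (∀ j → F (suc i , j) ≡ nothing) →
               ∃[ F′ ] F ⟶[ d ] F′ × F′ (i , 0) ≡ just x × (∀ p → proj₁ p ≢ i → F′ p ≡ F p)
contract-row i zero {F} filled last beyond below = F , ⟶-refl , last , λ _ _ → refl
contract-row {x} i (suc d) {F} filled last beyond below =
  let y , e = filled (n≤1+n d)
      F″ , steps , e′ , agree = contract-row i d filled′ last′ (≔-same _ _)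
        (λ j → trans (↤-unmoved (row≢ n≢1+n) (row≢ n≢1+n)) (below j))
  -- Deleting the entry just before the last one pulls the last one left by one cell.
  in F″ , ⟶-step e (right last λ e″ → ⊥-elim (just≢nothing e″ (below d))) last
            (beyond , below (suc d)) steps ,
     e′ , λ p p≢ → trans (agree p p≢) (↤-unmoved (row≢ (p≢ ∘ sym)) (row≢ (p≢ ∘ sym)))
  where
  F′ : Cells
  F′ = F [ (i , d) ↤ (i , suc d) ]
  last′ : F′ (i , d) ≡ just x
  last′ = trans (↤-moved (column≢ (n≢1+n ∘ sym))) last
  filled′ : ∀ {j} → j ≤ d → ∃[ y ] F′ (i , j) ≡ just y
  filled′ j≤d with m≤n⇒m<n∨m≡n j≤d
  ... | inj₂ refl = _ , last′
  ... | inj₁ j<d with y , e ← filled (m≤n⇒m≤1+n j≤d) =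
    y , trans (↤-unmoved (column≢ (>⇒≢ j<d)) (column≢ (>⇒≢ (s≤s j≤d)))) e

-- Tableaux of square shape with the lower-right cell missing

getRow-< : ∀ r → getRow r j ≡ just x → j < length r
getRow-< {zero}  (x ∷ r) e = s≤s z≤n
getRow-< {suc j} (x ∷ r) e = s≤s (getRow-< r e)

<-getRow : ∀ r → j < length r → ∃[ x ] getRow r j ≡ just x
<-getRow {zero}  (x ∷ r) _         = x , refl
<-getRow {suc j} (x ∷ r) (s≤s j<l) = <-getRow r j<l

shape-bound : ∀ t → getRow (shape t) i ≡ just n → get t i j ≡ just x → j < n
shape-bound {zero}  (r ∷ t) refl e = getRow-< r e
shape-bound {suc i} (r ∷ t) l    e = shape-bound t l e

shape-filled : ∀ t → getRow (shape t) i ≡ just n → j < n → ∃[ x ] get t i j ≡ just x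
shape-filled {zero}  (r ∷ t) refl j<n = <-getRow r j<n
shape-filled {suc i} (r ∷ t) l    j<n = shape-filled t l j<n

shape-outside : ∀ t i → getRow (shape t) i ≡ nothing → get t i j ≢ just x
shape-outside []      i       l ()
shape-outside (r ∷ t) zero    () e
shape-outside (r ∷ t) (suc i) l e = shape-outside t i l e

replicate-row : ∀ k → i < k → getRow (replicate k x ++ [ y ]) i ≡ just x
replicate-row {zero}  (suc k) _         = refl
replicate-row {suc i} (suc k) (s≤s i<k) = replicate-row k i<k

last-row : ∀ k → getRow (replicate k x ++ [ y ]) k ≡ just y
last-row zero    = refl
last-row (suc k) = last-row k

no-row : ∀ k → k < i → getRow (replicate k x ++ [ y ]) i ≡ nothing
no-row {suc i} zero    _         = refl
no-row {suc i} (suc k) (s≤s k<i) = no-row k k<i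

Inside : ℕ → Position → Set
Inside k (i , j) = (i < k × j ≤ k) ⊎ (i ≡ k × j < k)

-- The hypotheses on shape and entries, restated by position: the permutation of `1` to `n` becomes
-- injectivity and an upper bound.
record IsBoard (k n : ℕ) (t : Tableau) : Set where
  field
    inside     : ∀ p {x} → cell t p ≡ just x → Inside k p
    filled     : ∀ p → Inside k p → ∃[ x ] cell t p ≡ just x
    injective  : ∀ p q {x} → cell t p ≡ just x → cell t q ≡ just x → p ≡ q
    bounded    : ∀ p {x} → cell t p ≡ just x → x ≤ n
    row-<      : ∀ {i j a b} → cell t (i , j) ≡ just a → cell t (i , suc j) ≡ just b → a < b
    column-<   : ∀ {i j a b} → cell t (i , j) ≡ just a → cell t (suc i , j) ≡ just b → a < b
    nonEmpty   : All NonEmpty t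

  outside : ∀ p → ¬ Inside k p → cell t p ≡ nothing
  outside p ¬in with cell t p in e
  ... | nothing = refl
  ... | just _  = ⊥-elim (¬in (inside p e))

  represents : Represents (cell t) t
  represents = record
    { label     = id
    ; label-<   = λ _ _ _ _ x<y → x<y
    ; cells     = λ p → sym (map-id (cell t p))
    ; injective = injective
    ; nonEmpty  = nonEmpty
    }

unique-getRow : ∀ r {xs} → Unique (r ++ xs) → getRow r i ≡ just x → getRow r j ≡ just x → i ≡ j
unique-getRow {zero}  {j = zero}  (x ∷ r) u       e    e′   = refl
unique-getRow {zero}  {j = suc j} (x ∷ r) (x∉ ∷ u) refl e′ = ⊥-elim (All.lookup x∉ (∈-++⁺ˡ (getRow-∈ r e′)) refl)
unique-getRow {suc i} {j = zero}  (x ∷ r) (x∉ ∷ u) e refl = ⊥-elim (All.lookup x∉ (∈-++⁺ˡ (getRow-∈ r e)) refl)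
unique-getRow {suc i} {j = suc j} (x ∷ r) (_ ∷ u)  e    e′ = cong suc (unique-getRow r u e e′)

unique-disjoint : ∀ r {xs} → Unique (r ++ xs) → x ∈ r → ¬ x ∈ xs
unique-disjoint (x ∷ r) (x∉ ∷ u) (here refl) x∈xs = All.lookup x∉ (∈-++⁺ʳ r x∈xs) refl
unique-disjoint (x ∷ r) (_ ∷ u)  (there x∈r) x∈xs = unique-disjoint r u x∈r x∈xs

unique-++⁻ʳ : ∀ r {xs : List ℕ} → Unique (r ++ xs) → Unique xs
unique-++⁻ʳ []      u       = u
unique-++⁻ʳ (x ∷ r) (_ ∷ u) = unique-++⁻ʳ r u

unique-cell : ∀ t → Unique (concat t) → ∀ p q → cell t p ≡ just x → cell t q ≡ just x → p ≡ q
unique-cell (r ∷ t) u (zero  , j) (zero   , j′) e e′ = cong (0 ,_) (unique-getRow r u e e′)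
unique-cell (r ∷ t) u (zero  , j) (suc i′ , j′) e e′ = ⊥-elim (unique-disjoint r u (getRow-∈ r e) (cell-∈ t e′))
unique-cell (r ∷ t) u (suc i , j) (zero   , j′) e e′ = ⊥-elim (unique-disjoint r u (getRow-∈ r e′) (cell-∈ t e))
unique-cell (r ∷ t) u (suc i , j) (suc i′ , j′) e e′ =
  cong (λ (a , b) → suc a , b) (unique-cell t (unique-++⁻ʳ r u) (i , j) (i′ , j′) e e′)

isBoard : IsYT n t → shape t ≡ squareMinusCorner k → IsBoard k n t
isBoard {n} {t} {k} yt sh = record
  { inside    = inside
  ; filled    = filled
  ; injective = λ p q → unique-cell t (Unique-resp-↭ (↭⇒↭ₛ (↭-sym entries))
                  (applyUpTo⁺₁ suc n (λ i<j _ → <⇒≢ (s≤s i<j)))) p q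
  ; bounded   = λ p e → bound (∈-applyUpTo⁻ suc (∈-resp-↭ entries (cell-∈ t e)))
  ; row-<     = rowIncreasing _ _ _ _
  ; column-<  = colIncreasing _ _ _ _
  ; nonEmpty  = rowsNonEmpty
  }
  where
  open IsYT yt
  open Permutation (setoid ℕ) using (Unique-resp-↭)
  bound : (∃[ i ] i < n × x ≡ suc i) → x ≤ n
  bound (i , i<n , refl) = i<n
  row : ∀ {l} i → getRow (squareMinusCorner k) i ≡ l → getRow (shape t) i ≡ l
  row i e = trans (cong (λ s → getRow s i) sh) e
  inside : ∀ p {x} → cell t p ≡ just x → Inside k p
  inside (i , j) e with <-cmp i k
  ... | tri< i<k _ _  = inj₁ (i<k , ≤-pred (shape-bound t (row i (replicate-row k i<k)) e))
  ... | tri≈ _ refl _ = inj₂ (refl , shape-bound t (row i (last-row k)) e)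
  ... | tri> _ _ k<i  = ⊥-elim (shape-outside t i (row i (no-row k k<i)) e)
  filled : ∀ p → Inside k p → ∃[ x ] cell t p ≡ just x
  filled (i , j) (inj₁ (i<k , j≤k))  = shape-filled t (row i (replicate-row k i<k)) (s≤s j≤k)
  filled (i , j) (inj₂ (refl , j<k)) = shape-filled t (row k (last-row k)) j<k

-- The two corners

module _ (q : ℕ) where
  private
    -- `K` is the `k` of the theorem, with `2 ≤ k` built in so that `suc q` and `q` stand for k - 1
    -- and k - 2. The positions below are A, B and C.
    K : ℕ
    K = suc (suc q)
    rightCorner bottomCorner innerCorner : Position
    rightCorner  = suc q , K
    bottomCorner = K , suc q
    innerCorner  = suc q , suc q

  right-of-board : K < j → ¬ Inside K (i , j)
  right-of-board K<j (inj₁ (_ , j≤K)) = <⇒≱ K<j j≤K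
  right-of-board K<j (inj₂ (_ , j<K)) = <-asym K<j j<K

  below-board : ∀ j → ¬ Inside K (suc K , j)
  below-board j (inj₁ (i<K , _))  = <⇒≱ i<K (n≤1+n K)
  below-board j (inj₂ (i≡K , _)) = n≢1+n (sym i≡K)

  missing-corner : ¬ Inside K (K , K)
  missing-corner (inj₁ (K<K , _)) = <-irrefl refl K<K
  missing-corner (inj₂ (_ , K<K)) = <-irrefl refl K<K

  -- As the cell (k,k) is missing, only C, A and B lie weakly south-east of C; an entry of a minor
  -- at C has one of these as its origin.
  beyond-inner : ∀ {p} → innerCorner ⊴ p → Inside K p →
                 p ≡ innerCorner ⊎ p ≡ rightCorner ⊎ p ≡ bottomCorner
  beyond-inner (i≥ , j≥) (inj₁ (i<K , j≤K)) with refl ← ≤-antisym i≥ (≤-pred i<K) with m≤n⇒m<n∨m≡n j≤K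
  ... | inj₁ j<K with refl ← ≤-antisym j≥ (≤-pred j<K) = inj₁ refl
  ... | inj₂ refl = inj₂ (inj₁ refl)
  beyond-inner (i≥ , j≥) (inj₂ (refl , j<K)) with refl ← ≤-antisym j≥ (≤-pred j<K) = inj₂ (inj₂ refl)

  -- At any other cell there is a right or lower neighbour, whose entry would exceed `n`.
  max-corner : ∀ {p} → IsBoard K n t → cell t p ≡ just n → p ≡ rightCorner ⊎ p ≡ bottomCorner
  max-corner {n} {t} {p@(i , j)} B e with IsBoard.inside B p e
  ... | inj₁ (i<K , j≤K) with m≤n⇒m<n∨m≡n j≤K
  ...   | inj₁ j<K =
    let _ , e′ = filled (i , suc j) (inj₁ (i<K , j<K))
    in ⊥-elim (<⇒≱ (row-< e e′) (bounded (i , suc j) e′))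
    where open IsBoard B
  ...   | inj₂ refl with m≤n⇒m<n∨m≡n i<K
  ...     | inj₁ 1+i<K =
    let _ , e′ = filled (suc i , j) (inj₁ (1+i<K , ≤-refl))
    in ⊥-elim (<⇒≱ (column-< e e′) (bounded (suc i , j) e′))
    where open IsBoard B
  ...     | inj₂ refl = inj₁ refl
  max-corner {n} {t} {p@(i , j)} B e | inj₂ (refl , j<K) with m≤n⇒m<n∨m≡n j<K
  ...   | inj₁ 1+j<K =
    let _ , e′ = filled (i , suc j) (inj₂ (refl , 1+j<K))
    in ⊥-elim (<⇒≱ (row-< e e′) (bounded (i , suc j) e′))
    where open IsBoard B
  ...   | inj₂ refl = inj₂ refl

  -- The entry above A is deleted, which pulls `n` up, and then the bottom row is contracted to its
  -- last entry: 1 + (k - 1) = k deletions. The three values `x`, `y`, `z` come from C, B and A.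
  hook-minor : IsBoard K n t → cell t rightCorner ≡ just n →
               ∃[ u ] Minor K t u × ∃[ x ] ∃[ y ] ∃[ z ]
                 cell u innerCorner ≡ just x × cell u (K , 0) ≡ just y × cell u (q , K) ≡ just z ×
                 x < y × y < z
  hook-minor {n} {t} B eₙ =
    let _ , e           = filled (q , K) (inj₁ (n≤1+n (suc q) , ≤-refl))
        w , e-w         = filled innerCorner (inj₁ (≤-refl , n≤1+n (suc q)))
        b , e-b         = filled bottomCorner (inj₂ (refl , ≤-refl))
        _ , steps , e-b′ , agree = contract-row K (suc q)
          (λ {j} j≤ → let y , e′ = filled (K , j) (inj₂ (refl , s≤s j≤)) in y , kept e′)
          (kept e-b)
          (trans (↤-unmoved (row≢ λ ()) (row≢ n≢1+n)) (outside _ missing-corner))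
          (λ j → trans (↤-unmoved (row≢ λ ()) (row≢ λ ())) (outside _ (below-board j)))
        -- Nothing lies to the right of the last column, so the hole above A must move down.
        u , minor , R   = ⟶-step e (down (outside _ (right-of-board ≤-refl)) eₙ) eₙ
                            (outside _ (right-of-board ≤-refl) , outside _ missing-corner)
                            steps represents
        open Represents R using (label-<; cell-just)
        f-w = trans (agree innerCorner n≢1+n) (trans (↤-unmoved (row≢ n≢1+n) (column≢ (n≢1+n ∘ sym))) e-w)
        f-n = trans (agree (q , K) (λ ())) (trans (↤-moved (row≢ (n≢1+n ∘ sym))) eₙ)
        b<n = ≤∧≢⇒< (bounded bottomCorner e-b)
                λ b≡n → row≢ (n≢1+n ∘ sym)
                  (injective bottomCorner rightCorner (trans e-b (cong just b≡n)) eₙ)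
    in u , minor , _ , _ , _ , cell-just _ f-w , cell-just _ e-b′ , cell-just _ f-n ,
       label-< innerCorner (K , 0) f-w e-b′ (column-< e-w e-b) , label-< (K , 0) (q , K) e-b′ f-n b<n
    where
    open IsBoard B
    kept : cell t (K , j) ≡ just x → (cell t [ (q , K) ↤ rightCorner ]) (K , j) ≡ just x
    kept e = trans (↤-unmoved (row≢ λ ()) (row≢ n≢1+n)) e

  -- South-east of (k,0) lies only the bottom row, which gives `b`. The entry at (k-2,k) comes from
  -- that cell or from A, so it is at most `a`, whence `b` lies below `a`. It remains to exclude A
  -- and B as origins of the entry at C.
  between-corners : IsBoard K n t → cell t bottomCorner ≡ just n → Traced u t →
                    ∀ {x y z} → cell u innerCorner ≡ just x → cell u (K , 0) ≡ just y →
                    cell u (q , K) ≡ just z → x < y → y < z →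
                    ∃[ j ] ∃[ w ] ∃[ b ] ∃[ a ] cell t innerCorner ≡ just w × cell t (K , j) ≡ just b ×
                      cell t rightCorner ≡ just a × w < b × b < a
  between-corners {n} {t} {u} B eₙ τ ex ey ez x<y y<z
    with p₁ , x , ⊴₁ , ex′ , refl ← Traced.origin τ innerCorner ex
       | p₂ , y , ⊴₂ , ey′ , refl ← Traced.origin τ (K , 0) ey
       | p₃ , z , ⊴₃ , ez′ , refl ← Traced.origin τ (q , K) ez
    = conclude (inside _ ey′) (beyond-inner ⊴₁ (inside _ ex′))
    where
    open IsBoard B
    open Traced τ
    rightEntry : ∃[ a ] cell t rightCorner ≡ just a
    rightEntry = filled rightCorner (inj₁ (≤-refl , ≤-refl))
    a = proj₁ rightEntry
    ea = proj₂ rightEntry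
    z≤a : z ≤ a
    z≤a with inside _ ez′
    ... | inj₂ (_ , j<K) = ⊥-elim (<⇒≱ j<K (proj₂ ⊴₃))
    ... | inj₁ (i<K , j≤K) with refl ← ≤-antisym (proj₂ ⊴₃) j≤K with m≤n⇒m<n∨m≡n (proj₁ ⊴₃)
    ...   | inj₂ refl = <⇒≤ (column-< ez′ ea)
    ...   | inj₁ q<i with refl ← ≤-antisym q<i (≤-pred i<K) =
      ≤-reflexive (just-injective (trans (sym ez′) ea))
    y<a : y < a
    y<a = <-≤-trans (reflects-< y<z) z≤a
    conclude : Inside K p₂ → p₁ ≡ innerCorner ⊎ p₁ ≡ rightCorner ⊎ p₁ ≡ bottomCorner → _
    conclude (inj₁ (i<K , _)) _ = ⊥-elim (<⇒≱ i<K (proj₁ ⊴₂))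
    conclude (inj₂ (refl , _)) (inj₁ refl) = _ , _ , _ , _ , ex′ , ey′ , ea , reflects-< x<y , y<a
    -- From A the entry would be `a`, which exceeds `y`.
    conclude _ (inj₂ (inj₁ refl)) with refl ← just-injective (trans (sym ex′) ea) =
      ⊥-elim (<-asym (reflects-< x<y) y<a)
    -- From B it would be `n`, and nothing exceeds `n`.
    conclude _ (inj₂ (inj₂ refl)) with refl ← just-injective (trans (sym ex′) eₙ) =
      ⊥-elim (<⇒≱ (reflects-< x<y) (bounded p₂ ey′))

  -- The innermost corner and the bottom row of t survive in every minor of t
  -- that has k full columns.
  module Rigid (B : IsBoard K n t) (eₙ : cell t rightCorner ≡ just n) (τ : Traced v t)
               (row-filled : ∀ {j} → j < K → ∃[ x ] cell v (K , j) ≡ just x)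
               (row-increasing : ∀ {j x y} → suc j < K → cell v (K , j) ≡ just x →
                                 cell v (K , suc j) ≡ just y → x < y)
               where
    open IsBoard B
    open Traced τ

    row-mono : j ≤ i → cell t (K , j) ≡ just x → cell t (K , i) ≡ just y → x ≤ y
    row-mono {j} {i} j≤i e e′ with m≤n⇒m<n∨m≡n j≤i
    ... | inj₂ refl = ≤-reflexive (just-injective (trans (sym e) e′))
    row-mono {j} {suc i} j≤i e e′ | inj₁ j<i with inside (K , suc i) e′
    ... | inj₁ (K<K , _) = ⊥-elim (<-irrefl refl K<K)
    ... | inj₂ (_ , i<K) =
      let _ , e″ = filled (K , i) (inj₂ (refl , <⇒≤ i<K))
      in ≤-trans (row-mono (≤-pred j<i) e e″) (<⇒≤ (row-< e″ e′))

    in-bottom-row : ∀ {p} → K ≤ proj₁ p → Inside K p → proj₁ p ≡ K × proj₂ p < K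
    in-bottom-row K≤i (inj₁ (i<K , _)) = ⊥-elim (<⇒≱ i<K K≤i)
    in-bottom-row K≤i (inj₂ at)        = at

    -- Induction on the distance `d` to the last cell of the row. If the entry came from further
    -- right, it would be at least the entry of `t` in column j + 1; but that one is the origin of
    -- the next entry of `v`, which is larger.
    row-origin : ∀ d {j x} → j + d ≡ suc q → cell v (K , j) ≡ just x →
                 ∃[ y ] cell t (K , j) ≡ just y × label y ≡ x
    row-origin d {j} j+d≡ e with p , y , ⊴p , e′ , refl ← origin (K , j) e
      with refl , j′<K ← in-bottom-row (proj₁ ⊴p) (inside p e′) with m≤n⇒m<n∨m≡n (proj₂ ⊴p)
    ... | inj₂ refl = y , e′ , refl
    row-origin zero {j} j+0≡ e | inj₁ j<j′ =
      ⊥-elim (<⇒≱ j′<K (subst (_< _) (trans (sym (+-identityʳ j)) j+0≡) j<j′))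
    row-origin (suc d) {j} j+d≡ e | inj₁ j<j′ =
      let 1+j+d≡ = trans (sym (+-suc j d)) j+d≡
          1+j<K = s≤s (≤-trans (m≤m+n (suc j) d) (≤-reflexive 1+j+d≡))
          _ , e₁ = row-filled 1+j<K
          z , e₂ , eq = row-origin d 1+j+d≡ e₁
          y<z = reflects-< (subst (label y <_) (sym eq) (row-increasing 1+j<K e e₁))
      in ⊥-elim (<⇒≱ y<z (row-mono j<j′ e₂ e′))

    row-origin′ : j < K → cell v (K , j) ≡ just x → ∃[ y ] cell t (K , j) ≡ just y × label y ≡ x
    row-origin′ {j} j<K = row-origin (suc q ∸ j) (m+[n∸m]≡n (≤-pred j<K))

    -- The entry of `v` at B comes from B. An entry at C smaller than it can come neither from A,
    -- which holds the maximum `n`, nor from B itself.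
    inner-origin : cell v innerCorner ≡ just x → cell v bottomCorner ≡ just y → x < y →
                   ∃[ w ] cell t innerCorner ≡ just w × label w ≡ x
    inner-origin e e′ x<y
      with b , eb , refl ← row-origin′ ≤-refl e′
      with p , w , ⊴p , ew , refl ← origin innerCorner e
      with beyond-inner ⊴p (inside p ew)
    ... | inj₁ refl        = w , ew , refl
    ... | inj₂ (inj₁ refl) with refl ← just-injective (trans (sym ew) eₙ) =
      ⊥-elim (<⇒≱ (reflects-< x<y) (bounded bottomCorner eb))
    ... | inj₂ (inj₂ refl) with refl ← just-injective (trans (sym ew) eb) = ⊥-elim (<-irrefl refl x<y)

  -- F stands for s, possibly with another entry in the innermost corner.
  transfer : ∀ {s F b} → IsBoard K n t → cell t rightCorner ≡ just n → IsBoard K n s →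
             Traced v t → Represents F v → (∀ j → j < K → F (K , j) ≡ cell s (K , j)) →
             F innerCorner ≡ just x → F bottomCorner ≡ just y → x < y → cell s (K , j) ≡ just b →
             ∃[ w ] ∃[ c ] cell t innerCorner ≡ just w × cell t (K , j) ≡ just c ×
               (x < b → w < c) × (b < x → c < w)
  transfer {v = v} {j = j} {s = s} {F} {b} Bₜ eₙ Bₛ τ R agree ex ey x<y eb =
    let w , ew , lw = inner-origin (cell-just _ ex) (cell-just _ ey) (label-< _ _ ex ey x<y)
        c , ec , lc = row-origin′ j<K (cell-just _ eb′)
    -- Each comparison is carried from `F` to `v` by `label-<` and from `v` back to `t` by
    -- `reflects-<`.
    in w , c , ew , ec ,
       (λ x<b → reflects-< (subst₂ _<_ (sym lw) (sym lc) (label-< _ _ ex eb′ x<b))) ,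
       (λ b<x → reflects-< (subst₂ _<_ (sym lc) (sym lw) (label-< _ _ eb′ ex b<x)))
    where
    open Represents R using (label; label-<; cell-just; cells)
    open Traced τ using (reflects-<)
    open IsBoard Bₛ using (inside; filled; row-<)
    in-row : ∀ {i} → Inside K (K , i) → i < K
    in-row (inj₁ (K<K , _)) = ⊥-elim (<-irrefl refl K<K)
    in-row (inj₂ (_ , i<K)) = i<K
    j<K : j < K
    j<K = in-row (inside _ eb)
    row-filled : ∀ {i} → i < K → ∃[ a ] cell v (K , i) ≡ just a
    row-filled {i} i<K with a , e ← filled (K , i) (inj₂ (refl , i<K)) =
      label a , cell-just _ (trans (agree i i<K) e)
    row-increasing : ∀ {i a b} → suc i < K → cell v (K , i) ≡ just a →
                     cell v (K , suc i) ≡ just b → a < b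
    row-increasing {i} i<K e e′
      with a , ea , refl ← map-just {f = label} (trans (sym (cells (K , i))) e)
         | c , ec , refl ← map-just {f = label} (trans (sym (cells (K , suc i))) e′) =
      label-< (K , i) (K , suc i) ea ec
        (row-< (trans (sym (agree i (<⇒≤ i<K))) ea) (trans (sym (agree (suc i) i<K)) ec))
    eb′ : F (K , j) ≡ just b
    eb′ = trans (agree j j<K) eb
    open Rigid Bₜ eₙ τ row-filled row-increasing using (inner-origin; row-origin′)

  -- Two minors of `s` compare the entries of `t` at C and in column `j` of the bottom row in
  -- opposite ways.
  corners-differ : IsBoard K n t → cell t rightCorner ≡ just n →
                   ∀ {s} → IsBoard K n s → cell s bottomCorner ≡ just n →
                   (∀ {u} → Minor K t u → Minor K s u) → (∀ {v} → Minor K s v → Minor K t v) → ⊥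
  corners-differ {n} {t} Bₜ eₙ {s} Bₛ eₙ′ t⇒s s⇒t =
    let u , minor , _ , _ , _ , ex , ey , ez , x<y , y<z = hook-minor Bₜ eₙ
        j , w , b , a , ew , eb , ea , w<b , b<a =
          between-corners Bₛ eₙ′ (minor-traced (t⇒s minor)) ex ey ez x<y y<z
        a<n = ≤∧≢⇒< (bounded rightCorner ea) λ a≡n →
          row≢ n≢1+n (injective rightCorner bottomCorner (trans ea (cong just a≡n)) eₙ′)

        -- First minor: the whole right column is erased, so C still holds `w`, which is smaller
        -- than `b`.
        _ , steps₀ , agree₀ = erase-column K
          (λ {i} i<K → filled (i , K) (inj₁ (i<K , ≤-refl)))
          (λ i → outside _ (right-of-board ≤-refl)) (outside _ missing-corner)
        v₀ , minor₀ , R₀ = steps₀ represents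
        w₀ , c₀ , ew₀ , ec₀ , above , _ =
          transfer Bₜ eₙ Bₛ (minor-traced (s⇒t minor₀)) R₀ (λ j j<K → agree₀ (K , j) (<⇒≢ j<K))
            (trans (agree₀ innerCorner n≢1+n) ew) (trans (agree₀ bottomCorner n≢1+n) eₙ′)
            (<-trans w<b (<-trans b<a a<n)) eb

        -- Second minor: once `w` is deleted and `a` has moved from A to C, the right column has k -
        -- 1 entries left to erase, k deletions in all. Now C holds `a`, which is larger than `b`.
        _ , steps₁ , agree₁ = erase-column (suc q)
          (λ {i} i<1+q → let x , e = filled (i , K) (inj₁ (m<n⇒m<1+n i<1+q , ≤-refl)) in
            x , trans (↤-unmoved (row≢ (>⇒≢ i<1+q)) (row≢ (>⇒≢ i<1+q))) e)
          (λ i → trans (↤-unmoved (column≢ λ ()) (column≢ n≢1+n)) (outside _ (right-of-board ≤-refl)))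
          (≔-same _ _)
        v₁ , minor₁ , R₁ = ⟶-step ew
          -- The hole at C moves right because the entry below it is `n`, at B, and `a` is smaller.
          (right ea λ e → subst (a <_) (just-injective (trans (sym eₙ′) e)) a<n) ea
          (outside _ (right-of-board ≤-refl) , outside _ missing-corner) steps₁ represents
        agree₁′ = λ j j<K → trans (agree₁ (K , j) (<⇒≢ j<K))
                                  (↤-unmoved {F = cell s} (row≢ n≢1+n) (row≢ n≢1+n))
        w₁ , c₁ , ew₁ , ec₁ , _ , below =
          transfer Bₜ eₙ Bₛ (minor-traced (s⇒t minor₁)) R₁ agree₁′
            (trans (agree₁ innerCorner n≢1+n) (trans (↤-moved (column≢ (n≢1+n ∘ sym))) ea))
            (trans (agree₁′ (suc q) ≤-refl) eₙ′) a<n eb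
    in <-asym (above w<b) (subst₂ _<_ (just-injective (trans (sym ec₁) ec₀))
                                     (just-injective (trans (sym ew₁) ew₀)) (below b<a))
    where open IsBoard Bₛ

theorem5p4 : (k : ℕ) → 2 ≤ k →
    (T : Tableau) → IsYT ((suc k ^ 2) ∸ 1) T → shape T ≡ squareMinusCorner k →
    (S : Tableau) → IsYT ((suc k ^ 2) ∸ 1) S → shape S ≡ squareMinusCorner k →
    SameMinors k S T →
    (i j : ℕ) → get T i j ≡ just ((suc k ^ 2) ∸ 1) → get S i j ≡ just ((suc k ^ 2) ∸ 1)
theorem5p4 (suc zero) (s≤s ())
theorem5p4 (suc (suc q)) _ T ytT shT S ytS shS same i j e
  -- The entries of both tableaux are permutations of the same list, so the maximum also occurs
  -- somewhere in `S`.
  with p , e′ ← ∈-cell S (∈-resp-↭ (↭-trans (IsYT.entries ytT) (↭-sym (IsYT.entries ytS))) (cell-∈ T e))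
  with max-corner q {p = i , j} (isBoard ytT shT) e | max-corner q {p = p} (isBoard ytS shS) e′
... | inj₁ refl | inj₁ refl = e′
... | inj₂ refl | inj₂ refl = e′
... | inj₁ refl | inj₂ refl = ⊥-elim
  (corners-differ q (isBoard ytT shT) e (isBoard ytS shS) e′ (Equivalence.from (same _)) (Equivalence.to (same _)))
-- The same contradiction with the roles of `S` and `T` exchanged.
... | inj₂ refl | inj₁ refl = ⊥-elim
  (corners-differ q (isBoard ytS shS) e′ (isBoard ytT shT) e (Equivalence.to (same _)) (Equivalence.from (same _)))
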